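{- Let $\mathcal{H}$ be a pseudohemisphere hypergraph on a finite totally ordered vertex set $V$ such that every pair of hyperedges of $\mathcal{H}$ has a common vertex. Then there exists a set of at most four vertices of $V$ that intersects every hyperedge of $\mathcal{H}$.
   Context: A hypergraph $\mathcal{F}$ on a totally ordered finite vertex set $V$ (a family of subsets of $V$) is ABA-free if there are no two hyperedges $A,B\in\mathcal{F}$ and vertices $x<y<z$ with $x,z\in A\setminus B$ and $y\in B\setminus A$. For $F\subseteq V$ write $\bar F=V\setminus F$, and $\Delta$ denotes symmetric difference. A hypergraph $\mathcal{H}$ on $V$ is a pseudohemisphere hypergraph if there exist a set $X\subseteq V$ and an ABA-free hypergraph $\mathcal{F}$ on $V$ such that every hyperedge of $\mathcal{H}$ belongs to $\{F\Delta X,\ \bar F\Delta X : F\in\mathcal{F}\}$. -}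

module Defs where

open import Data.Nat using (ℕ)
open import Data.Bool using (_xor_)
open import Data.Fin using (Fin; _<_)
open import Data.Fin.Subset using (Subset; _∈_; _∉_; ∁)
open import Data.Vec using (zipWith)
open import Data.List using (List)
import Data.List.Membership.Propositional as LM
open import Data.Product using (Σ; ∃; _×_)
open import Data.Sum using (_⊎_)
open import Relation.Binary.PropositionalEquality using (_≡_)
open import Relation.Nullary using (¬_)

-- The vertex set V is Fin n with its natural total order
-- (every finite totally ordered set is order-isomorphic to some Fin n).
-- A hypergraph on V is a finite list of subsets of V.
Hypergraph : ℕ → Set
Hypergraph n = List (Subset n)

_Δ_ : ∀ {n} → Subset n → Subset n → Subset n
A Δ B = zipWith _xor_ A B

ABA-free : ∀ {n} → Hypergraph n → Set
ABA-free {n} F =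
  ∀ (A B : Subset n) → A LM.∈ F → B LM.∈ F →
  ∀ (x y z : Fin n) → x < y → y < z →
  ¬ ((x ∈ A × x ∉ B) × (z ∈ A × z ∉ B) × (y ∈ B × y ∉ A))

Pseudohemisphere : ∀ {n} → Hypergraph n → Set
Pseudohemisphere {n} H =
  Σ (Subset n) λ X → Σ (Hypergraph n) λ F → ABA-free F ×
    (∀ (E : Subset n) → E LM.∈ H →
       Σ (Subset n) λ G → G LM.∈ F × ((E ≡ G Δ X) ⊎ (E ≡ ∁ G Δ X)))

Intersecting : ∀ {n} → Hypergraph n → Set
Intersecting {n} H =
  ∀ (A B : Subset n) → A LM.∈ H → B LM.∈ H → ∃ λ (v : Fin n) → v ∈ A × v ∈ B

{-# OPTIONS --safe #-}

-- Picture the vertices as signed points and the sets of F as pseudolines. A vertical line through a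
-- vertex k splits the signed points into two sides, according to (v < k) xor (v ∈ X); sliding k
-- across V exchanges the sides, and no two edges lie on opposite sides, so for some k every edge
-- missing k has vertices on both sides. Turn the picture so that this line is at infinity; then k
-- comes first, and the edges missing k are ordered by slope. For p, q in an edge i on different
-- sides, the edges missing k, p and q are either all above i or all below i in that order. Take a
-- maximal i having a pair p, q of the first kind and a minimal j having a pair p′, q′ of the second
-- kind: no edge misses k, p, q, p′ and q′. If i or j has pairs of both kinds, two such pairs of it
-- can be chosen to share a point; otherwise every pair of i and of j can be used, and both can be
-- chosen to contain a common vertex of i and j. In either case three points and k suffice.
module Submission where

open import Defs
open import Data.Nat using (ℕ; _≤_)
open import Data.Fin using (Fin)
open import Data.Fin.Subset using (Subset; _∈_; ∣_∣)
import Data.List.Membership.Propositional as LM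
open import Data.Product using (Σ; ∃; _×_)

open import Algebra.Bundles using (module CommutativeRing)
import Algebra.Properties.CommutativeSemigroup as CommutativeSemigroupProperties
open import Data.Bool.Base using (Bool; true; false; not; _xor_)
import Data.Bool.Properties as Bool
open import Data.Empty using (⊥)
open import Data.Fin.Base as Fin using (toℕ; fromℕ<)
import Data.Fin.Properties as Fin
open import Data.Fin.Subset using (_∉_; ∁; _∪_; ⋃; ⁅_⁆)
open import Data.Fin.Subset.Properties using (∣⊥∣≡0; ∣⁅x⁆∣≡1; x∈⁅x⁆; x∈p∪q⁺)
open import Data.List.Base as List using (List; []; _∷_; length; filter; allFin)
open import Data.List.Membership.Propositional.Properties
  using (∈-filter⁺; ∈-filter⁻; ∈-allFin; ∈-lookup)
open import Data.List.Relation.Unary.All as All using (All; []; _∷_)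
open import Data.List.Relation.Unary.All.Properties using (¬Any⇒All¬)
open import Data.List.Relation.Unary.Any as Any using (Any; here; there)
open import Data.List.Relation.Unary.Any.Properties using (lookup-index)
open import Data.Nat.Base as ℕ using (zero; suc; z≤n; s≤s)
import Data.Nat.Properties as ℕ
open import Data.Product using (∃₂; _,_; proj₁; proj₂)
open import Data.Sum using (_⊎_; inj₁; inj₂)
open import Data.Vec.Base as Vec using ([]; _∷_)
open import Data.Vec.Properties
  using ([]=⇒lookup; lookup⇒[]=; lookup-map; lookup-zipWith)
open import Function using (flip; _∘_; case_of_)
open import Level using (0ℓ)
open import Relation.Binary
  using (Rel; Transitive; Tri; tri<; tri≈; tri>; IsStrictTotalOrder)
  renaming (Decidable to Decidable₂)
open import Relation.Binary.PropositionalEquality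
open import Relation.Nullary
  using (¬_; Dec; does; yes; no; contradiction; ¬?; _×-dec_; _⊎-dec_; _→-dec_)
open import Relation.Nullary.Decidable using (dec-true; dec-false; decidable-stable)
open import Relation.Unary using (Pred; Decidable)

-- Boolean sums and maximal elements of finite lists.

clash : ∀ {b : Bool} → b ≡ true → b ≡ false → ⊥
clash refl ()

open CommutativeSemigroupProperties
  (CommutativeRing.+-commutativeSemigroup Bool.xor-∧-commutativeRing)
  using () renaming (interchange to xor-interchange)

xor-cancelˡ : ∀ a b → a xor (a xor b) ≡ b
xor-cancelˡ false b = refl
xor-cancelˡ true  b = Bool.not-involutive b

xor-cancel : ∀ a b c → (a xor b) xor (a xor c) ≡ b xor c
xor-cancel a b c = trans (xor-interchange a b a c) (cong (_xor (b xor c)) (Bool.xor-same a))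

module _ {A : Set} {_<_ : Rel A 0ℓ} (irrefl : ∀ {x} → ¬ x < x) (<-trans : Transitive _<_)
         (_<?_ : Decidable₂ _<_) {P : Pred A 0ℓ} (P? : Decidable P) where

  -- The order may be partial: the kept element is replaced only by one that exceeds it, so by
  -- transitivity nothing rejected earlier can exceed the new one. It supplies the extreme edges in
  -- the slope order.
  maximal : ∀ xs → All (¬_ ∘ P) xs
          ⊎ ∃ λ x → x LM.∈ xs × P x × All (λ y → P y → ¬ x < y) xs
  maximal [] = inj₁ []
  maximal (x ∷ xs) with P? x | maximal xs
  ... | no ¬px | inj₁ none = inj₁ (¬px ∷ none)
  ... | no ¬px | inj₂ (m , m∈ , pm , max) =
    inj₂ (m , there m∈ , pm , (λ px _ → ¬px px) ∷ max)
  ... | yes px | inj₁ none =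
    inj₂ (x , here refl , px , (λ _ → irrefl) ∷ All.map (λ ¬py py _ → ¬py py) none)
  ... | yes px | inj₂ (m , m∈ , pm , max) with m <? x
  ...   | yes m<x = inj₂ (x , here refl , px , (λ _ → irrefl) ∷
                      All.map (λ ¬m<y py x<y → ¬m<y py (<-trans m<x x<y)) max)
  ...   | no m≮x  = inj₂ (m , there m∈ , pm , (λ _ → m≮x) ∷ max)

_∖_∋_ : ∀ {V : Set} → (V → Bool) → (V → Bool) → V → Set
(f ∖ g ∋ v) = f v ≡ true × g v ≡ false

-- Comparing the slopes of two pseudolines.

module Slope {n} {_≺_ : Rel (Fin n) 0ℓ} (≺-order : IsStrictTotalOrder _≡_ _≺_) where

  module ≺ = IsStrictTotalOrder ≺-order

  NoAlternation : (f g : Fin n → Bool) → Set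
  NoAlternation f g = ∀ {x y z} → x ≺ y → y ≺ z →
    f ∖ g ∋ x → g ∖ f ∋ y → f ∖ g ∋ z → ⊥

  -- The comparison of slopes when f and g are the sets of points above two pseudolines.
  _◁_ : (f g : Fin n → Bool) → Set
  f ◁ g = ∃₂ λ x y → x ≺ y × g ∖ f ∋ x × f ∖ g ∋ y

  ◁-dec : Decidable₂ _◁_
  ◁-dec f g = Fin.any? λ x → Fin.any? λ y → (x ≺.<? y) ×-dec
    ((g x Bool.≟ true) ×-dec (f x Bool.≟ false)) ×-dec ((f y Bool.≟ true) ×-dec (g y Bool.≟ false))

  module _ {f g : Fin n → Bool} (fg : NoAlternation f g) (gf : NoAlternation g f) where

    -- Of the two first vertices `a` and `c`, the earlier one followed by the whole of the other
    -- pair is a forbidden alternation.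
    ◁-asym : f ◁ g → ¬ g ◁ f
    ◁-asym (a , b , a≺b , ga , fb) (c , d , c≺d , fc , gd) with ≺.compare a c
    ... | tri< a≺c _ _ = gf a≺c c≺d ga fc gd
    ... | tri≈ _ refl _ = clash (proj₁ ga) (proj₂ fc)
    ... | tri> _ _ c≺a = fg c≺a a≺b fc ga fb

    -- One witness of `f ◁ g` orders all such pairs, because a pair in the reverse order would
    -- witness `g ◁ f`.
    ◁⇒≺ : f ◁ g → ∀ {x y} → g ∖ f ∋ x → f ∖ g ∋ y → x ≺ y
    ◁⇒≺ f◁g {x} {y} gx fy with ≺.compare x y
    ... | tri< x≺y _ _ = x≺y
    ... | tri≈ _ refl _ = contradiction (proj₂ fy) (clash (proj₁ gx))
    ... | tri> _ _ y≺x = contradiction (y , x , y≺x , fy , gx) (◁-asym f◁g)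

  -- The order of the edges by slope, as seen from the pivot `k`.

  module Edges {A : Set} (f : A → Fin n → Bool) (aba : ∀ i j → NoAlternation (f i) (f j))
               (k : Fin n) (k-min : ∀ {v} → v ≢ k → k ≺ v) (s : Fin n → Bool) where

    before : ∀ {i j x y} → f i ◁ f j → f j ∖ f i ∋ x → f i ∖ f j ∋ y → x ≺ y
    before {i} {j} i◁j = ◁⇒≺ (aba i j) (aba j i) i◁j

    -- If `f l` does not keep the pair `(a , b)` as a witness, then `c` replaces `a` or `d` replaces
    -- `b`, and `before` puts the new pair in order. In each remaining case some two vertices would
    -- be ordered both ways.
    ◁-trans : ∀ {i j l} → f i ◁ f j → f j ◁ f l → f i ◁ f l
    ◁-trans {i} {j} {l} ij@(a , b , a≺b , (ja , ia) , (ib , jb)) jl@(c , d , c≺d , (lc , jc) , (jd , ld))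
      with f l a in la | f l b in lb | f i c in ic | f i d in id
    ... | true  | false | _     | _     = a , b , a≺b , (la , ia) , (ib , lb)
    ... | true  | true  | _     | true  =
      a , d , ≺.trans a≺b (before jl (lb , jb) (jd , ld)) , (la , ia) , (id , ld)
    ... | true  | true  | _     | false =
      contradiction (before ij (jd , id) (ib , jb)) (≺.asym (before jl (lb , jb) (jd , ld)))
    ... | false | _     | true  | _     =
      contradiction (before ij (ja , ia) (ic , jc)) (≺.asym (before jl (lc , jc) (ja , la)))
    ... | false | false | false | _     =
      c , b , ≺.trans (before jl (lc , jc) (ja , la)) a≺b , (lc , ic) , (ib , lb)
    ... | false | true  | false | _     = contradiction (before jl (lb , jb) (ja , la)) (≺.asym a≺b)

    -- An edge missing k is above its pseudoline if f i k is false and below it otherwise; as the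
    -- half-plane turns about k, the lower ones come first and slopes increase within each class.
    _⋖_ : Rel A 0ℓ
    i ⋖ j = f i ∖ f j ∋ k ⊎ (f i k ≡ f j k × f i ◁ f j)

    _⋖?_ : Decidable₂ _⋖_
    i ⋖? j = ((f i k Bool.≟ true) ×-dec (f j k Bool.≟ false))
      ⊎-dec ((f i k Bool.≟ f j k) ×-dec ◁-dec (f i) (f j))

    ⋖-irrefl : ∀ {i} → ¬ i ⋖ i
    ⋖-irrefl (inj₁ (t , t′)) = clash t t′
    ⋖-irrefl {i} (inj₂ (_ , i◁i)) = ◁-asym (aba i i) (aba i i) i◁i i◁i

    ⋖-trans : Transitive _⋖_
    ⋖-trans (inj₁ (_ , jk)) (inj₁ (jk′ , _)) = contradiction jk (clash jk′)
    ⋖-trans (inj₁ (ik , jk)) (inj₂ (eq , _)) = inj₁ (ik , trans (sym eq) jk)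
    ⋖-trans (inj₂ (eq , _)) (inj₁ (jk , lk)) = inj₁ (trans eq jk , lk)
    ⋖-trans {i} {j} {l} (inj₂ (eq , ij)) (inj₂ (eq′ , jl)) =
      inj₂ (trans eq eq′ , ◁-trans {i} {j} {l} ij jl)

    ⋖-asym : ∀ {i j} → i ⋖ j → ¬ j ⋖ i
    ⋖-asym i⋖j j⋖i = ⋖-irrefl (⋖-trans i⋖j j⋖i)

    -- Membership of v in edge i, which misses k, when s tells the side of the line at infinity.
    hits : A → Fin n → Bool
    hits i v = (f i k xor f i v) xor s v

    Crossing : A → Fin n → Fin n → Set
    Crossing i p q = (s p ≡ true × hits i p ≡ true) × (s q ≡ false × hits i q ≡ true)

    Misses : A → Fin n → Fin n → Set
    Misses i p q = hits i p ≡ false × hits i q ≡ false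

    -- The sum defining `hits` is invertible. The right-hand side is arranged so that constants for
    -- `b` and `c` reduce it to `f i k` or `not (f i k)`.
    hits⇒value : ∀ i {v b c} → s v ≡ c → hits i v ≡ b → f i v ≡ (c xor b) xor f i k
    hits⇒value i {v} refl refl = begin
      f i v                               ≡⟨ xor-cancelˡ (f i k) (f i v) ⟨
      f i k xor (f i k xor f i v)         ≡⟨ cong (f i k xor_) (xor-cancelˡ (s v) _) ⟨
      f i k xor (s v xor (s v xor (f i k xor f i v)))
        ≡⟨ cong (λ h → f i k xor (s v xor h)) (Bool.xor-comm (s v) (f i k xor f i v)) ⟩
      f i k xor (s v xor hits i v)        ≡⟨ Bool.xor-comm (f i k) _ ⟩
      (s v xor hits i v) xor f i k        ∎
      where open ≡-Reasoning

    crossing-values : ∀ {i p q} → Crossing i p q → f i p ≡ f i k × f i q ≡ not (f i k)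
    crossing-values {i} ((sp , hp) , (sq , hq)) = hits⇒value i sp hp , hits⇒value i sq hq

    missing-values : ∀ {i j p q} → Crossing i p q → Misses j p q →
                     f j p ≡ not (f j k) × f j q ≡ f j k
    missing-values {j = j} ((sp , _) , (sq , _)) (hp , hq) = hits⇒value j sp hp , hits⇒value j sq hq

    -- If `i` and `j` have different values at `k`, these decide. Otherwise `i` and `j` differ at
    -- both `p` and `q`, in opposite ways, so the order of `p` and `q` determines which slope is
    -- smaller.
    missing-comparable : ∀ {i j p q} → Crossing i p q → Misses j p q → i ⋖ j ⊎ j ⋖ i
    missing-comparable {i} {j} {p} {q} cr ms
      with f i k in ik | f j k in jk | crossing-values cr | missing-values cr ms
    ... | true  | false | _ | _ = inj₁ (inj₁ (refl , refl))
    ... | false | true  | _ | _ = inj₂ (inj₁ (refl , refl))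
    ... | false | false | ip , iq | jp , jq with ≺.compare p q
    ...   | tri< p≺q _ _ = inj₁ (inj₂ (refl , p , q , p≺q , (jp , ip) , (iq , jq)))
    ...   | tri≈ _ refl _ = contradiction ip (clash iq)
    ...   | tri> _ _ q≺p = inj₂ (inj₂ (refl , q , p , q≺p , (iq , jq) , (jp , ip)))
    missing-comparable {i} {j} {p} {q} cr ms
        | true | true | ip , iq | jp , jq with ≺.compare p q
    ...   | tri< p≺q _ _ = inj₂ (inj₂ (refl , p , q , p≺q , (ip , jp) , (jq , iq)))
    ...   | tri≈ _ refl _ = contradiction iq (clash ip)
    ...   | tri> _ _ q≺p = inj₁ (inj₂ (refl , q , p , q≺p , (jq , iq) , (ip , jp)))

    -- The vertices k ≺ p ≺ q would form an alternation of j and l.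
    missing-opposite : ∀ {i j l p q} → Crossing i p q → Misses j p q → Misses l p q →
                       f j ∖ f l ∋ k → ¬ p ≺ q
    missing-opposite {j = j} {l} cr mj ml (jk , lk) p≺q =
      aba j l (k-min λ { refl → clash jk jp }) p≺q (jk , lk) (lp , jp) (jq , lq)
      where
      jp = trans (proj₁ (missing-values cr mj)) (cong not jk)
      jq = trans (proj₂ (missing-values cr mj)) jk
      lp = trans (proj₁ (missing-values cr ml)) (cong not lk)
      lq = trans (proj₂ (missing-values cr ml)) lk

    -- Along `j`, `i`, `l` the value at `k` can only drop from true to false. If it is constant, the
    -- two slope comparisons order `p` and `q` oppositely. If it drops, the comparison between edges
    -- of equal value gives `p ≺ q`, which `missing-opposite` excludes.
    missing-one-sided : ∀ {i j l p q} → Crossing i p q → Misses j p q → Misses l p q →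
                        j ⋖ i → ¬ i ⋖ l
    missing-one-sided {i} {j} {l} {p} {q} cr mj ml j⋖i i⋖l
      with f i k in ik | f j k in jk | f l k in lk
         | crossing-values cr | missing-values cr mj | missing-values cr ml | j⋖i | i⋖l
    ... | false | true  | false | ip , iq | _ | lp , lq | _ | inj₂ (_ , il) =
      missing-opposite cr mj ml (jk , lk) (before {i} {l} il (lp , ip) (iq , lq))
    ... | true  | true  | false | ip , iq | jp , jq | _ | inj₂ (_ , ji) | _ =
      missing-opposite cr mj ml (jk , lk) (before {j} {i} ji (ip , jp) (jq , iq))
    ... | false | false | false | ip , iq | jp , jq | lp , lq | inj₂ (_ , ji) | inj₂ (_ , il) =
      ≺.asym (before {j} {i} ji (iq , jq) (jp , ip)) (before {i} {l} il (lp , ip) (iq , lq))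
    ... | true  | true  | true  | ip , iq | jp , jq | lp , lq | inj₂ (_ , ji) | inj₂ (_ , il) =
      ≺.asym (before {j} {i} ji (ip , jp) (jq , iq)) (before {i} {l} il (lq , iq) (ip , lp))

    crossing? : ∀ i p q → Dec (Crossing i p q)
    crossing? i p q = ((s p Bool.≟ true) ×-dec (hits i p Bool.≟ true))
                ×-dec ((s q Bool.≟ false) ×-dec (hits i q Bool.≟ true))

    misses? : ∀ i p q → Dec (Misses i p q)
    misses? i p q = (hits i p Bool.≟ false) ×-dec (hits i q Bool.≟ false)

    -- Three vertices meeting all edges that miss the pivot.

    module _ (is : List A)
             (intersecting : ∀ {i j} → i LM.∈ is → j LM.∈ is →
                             ∃ λ v → hits i v ≡ true × hits j v ≡ true)
             (meets : ∀ {i} → i LM.∈ is → ∀ b → ∃ λ v → s v ≡ b × hits i v ≡ true) where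

      MissedAbove MissedBelow : A → Fin n → Fin n → Set
      MissedAbove i p q = All (λ j → Misses j p q → i ⋖ j) is
      MissedBelow i p q = All (λ j → Misses j p q → j ⋖ i) is

      one-sided : ∀ {i p q} → Crossing i p q → MissedAbove i p q ⊎ MissedBelow i p q
      one-sided {i} {p} {q} cr with Any.any? (λ j → misses? j p q ×-dec (i ⋖? j)) is
      -- A pair missed by no edge at all also ends up here, with `MissedBelow` holding vacuously.
      ... | no none = inj₂ (All.tabulate λ {j} j∈ mj → case missing-comparable cr mj of λ where
              (inj₁ i⋖j) → contradiction (LM.lose j∈ (mj , i⋖j)) none
              (inj₂ j⋖i) → j⋖i)
      ... | yes some = let l , _ , ml , i⋖l = LM.find some in
              inj₁ (All.tabulate λ {j} _ mj → case missing-comparable cr mj of λ where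
                (inj₁ i⋖j) → i⋖j
                (inj₂ j⋖i) → contradiction i⋖l (missing-one-sided cr mj ml j⋖i))

      Up Down : A → Set
      Up   i = ∃₂ λ p q → Crossing i p q × MissedAbove i p q
      Down i = ∃₂ λ p q → Crossing i p q × MissedBelow i p q

      up? : Decidable Up
      up? i = Fin.any? λ p → Fin.any? λ q → crossing? i p q ×-dec
        All.all? (λ j → misses? j p q →-dec (i ⋖? j)) is

      down? : Decidable Down
      down? i = Fin.any? λ p → Fin.any? λ q → crossing? i p q ×-dec
        All.all? (λ j → misses? j p q →-dec (j ⋖? i)) is

      crossing : ∀ {i} → i LM.∈ is → ∃₂ λ p q → Crossing i p q
      crossing i∈ = let p , P = meets i∈ true ; q , Q = meets i∈ false in p , q , P , Q

      up⊎down : ∀ {i} → i LM.∈ is → Up i ⊎ Down i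
      up⊎down i∈ = let p , q , cr = crossing i∈ in case one-sided cr of λ where
        (inj₁ above) → inj₁ (p , q , cr , above)
        (inj₂ below) → inj₂ (p , q , cr , below)

      Transversal : Set
      Transversal = ∃ λ u → ∃₂ λ v w →
        All (λ i → ¬ (hits i u ≡ false × hits i v ≡ false × hits i w ≡ false)) is

      module _ {i j} (gap : ∀ {l} → l LM.∈ is → i ⋖ l → ¬ l ⋖ j) where

        -- An edge missing all three vertices would lie strictly between `i` and `j`, in the gap.
        share-p : ∀ {p q q′} → MissedAbove i p q → MissedBelow j p q′ → Transversal
        share-p {p} {q} {q′} above below = p , q , q′ , All.tabulate λ l∈ (hp , hq , hq′) →
          gap l∈ (All.lookup above l∈ (hp , hq)) (All.lookup below l∈ (hp , hq′))

        share-q : ∀ {p p′ q} → MissedAbove i p q → MissedBelow j p′ q → Transversal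
        share-q {p} {p′} {q} above below = p , p′ , q , All.tabulate λ l∈ (hp , hp′ , hq) →
          gap l∈ (All.lookup above l∈ (hp , hq)) (All.lookup below l∈ (hp′ , hq))

      -- The mixed pair `p`, `q′` also crosses at `i`. Whichever kind it is, it shares a vertex with
      -- the given pair of the other kind, and asymmetry of `⋖` serves as the gap between `i` and
      -- itself.
      up×down⇒transversal : ∀ {i} → Up i → Down i → Transversal
      up×down⇒transversal (p , q , (P , Q) , above) (p′ , q′ , (P′ , Q′) , below)
        with one-sided (P , Q′)
      ... | inj₁ above′ = share-q (λ _ → ⋖-asym) above′ below
      ... | inj₂ below′ = share-p (λ _ → ⋖-asym) above below′

      transversal : Transversal
      transversal with maximal ⋖-irrefl ⋖-trans _⋖?_ up? is
                     | maximal {_<_ = flip _⋖_} ⋖-irrefl (flip ⋖-trans) (flip _⋖?_) down? is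
      -- Every listed edge has a pair of one of the two kinds, so the list is empty and any vertices
      -- will do.
      ... | inj₁ no-up | inj₁ no-down = k , k , k , All.tabulate λ i∈ _ → case up⊎down i∈ of λ where
              (inj₁ u) → All.lookup no-up i∈ u
              (inj₂ d) → All.lookup no-down i∈ d
      -- An edge missing `p` and `q` would be above `i` and have a pair of the first kind, against
      -- maximality. Two vertices suffice, so `p` is repeated.
      ... | inj₂ (i , i∈ , (p , q , cr , above) , max) | inj₁ no-down =
              p , p , q , All.tabulate λ l∈ (hp , _ , hq) → case up⊎down l∈ of λ where
                (inj₁ u) → All.lookup max l∈ u (All.lookup above l∈ (hp , hq))
                (inj₂ d) → All.lookup no-down l∈ d
      ... | inj₁ no-up | inj₂ (j , j∈ , (p , q , cr , below) , min) =
              p , p , q , All.tabulate λ l∈ (hp , _ , hq) → case up⊎down l∈ of λ where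
                (inj₁ u) → All.lookup no-up l∈ u
                (inj₂ d) → All.lookup min l∈ d (All.lookup below l∈ (hp , hq))
      ... | inj₂ (i , i∈ , up-i , max) | inj₂ (j , j∈ , down-j , min) with down? i | up? j
      ...   | yes down-i | _ = up×down⇒transversal up-i down-i
      ...   | no _ | yes up-j = up×down⇒transversal up-j down-j
      ...   | no ¬down-i | no ¬up-j = shared (intersecting i∈ j∈)
        where
        -- An edge in between would contradict the maximality of `i` or the minimality of `j`,
        -- according to the kind of its pair.
        gap : ∀ {l} → l LM.∈ is → i ⋖ l → ¬ l ⋖ j
        gap l∈ i⋖l l⋖j = case up⊎down l∈ of λ where
          (inj₁ u) → All.lookup max l∈ u i⋖l
          (inj₂ d) → All.lookup min l∈ d l⋖j

        above : ∀ {p q} → Crossing i p q → MissedAbove i p q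
        above {p} {q} cr = case one-sided cr of λ where
          (inj₁ a) → a
          (inj₂ b) → contradiction (p , q , cr , b) ¬down-i

        below : ∀ {p q} → Crossing j p q → MissedBelow j p q
        below {p} {q} cr = case one-sided cr of λ where
          (inj₁ a) → contradiction (p , q , cr , a) ¬up-j
          (inj₂ b) → b

        shared : (∃ λ v → hits i v ≡ true × hits j v ≡ true) → Transversal
        shared (v , iv , jv) = by-side (s v) refl (crossing i∈) (crossing j∈)
          where
          -- The common vertex `v` replaces the vertex on its own side in a crossing of `i` and in
          -- one of `j`, so the two pairs share it.
          by-side : ∀ b → s v ≡ b → (∃₂ λ p q → Crossing i p q) → (∃₂ λ p q → Crossing j p q) →
                    Transversal
          by-side true  sv (_ , _ , _ , Q) (_ , _ , _ , Q′) =
            share-p gap (above ((sv , iv) , Q)) (below ((sv , jv) , Q′))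
          by-side false sv (_ , _ , P , _) (_ , _ , P′ , _) =
            share-q gap (above (P , (sv , iv))) (below (P′ , (sv , jv)))

-- Cyclic shifts of the vertex order.

module Rotation {n} (low : Fin n → Bool)
                (low-initial : ∀ {v w} → low v ≡ true → low w ≡ false → v Fin.< w) where

  data _≺_ (v w : Fin n) : Set where
    stay : low v ≡ low w → v Fin.< w → v ≺ w
    wrap : low v ≡ false → low w ≡ true → v ≺ w

  ≺-irrefl : ∀ {v} → ¬ v ≺ v
  ≺-irrefl (stay _ v<v) = Fin.<-irrefl refl v<v
  ≺-irrefl (wrap f t) = clash t f

  ≺-trans : Transitive _≺_
  ≺-trans (stay eq v<w) (stay eq′ w<u) = stay (trans eq eq′) (Fin.<-trans v<w w<u)
  ≺-trans (stay eq _) (wrap f t) = wrap (trans eq f) t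
  ≺-trans (wrap f t) (stay eq _) = wrap f (trans (sym eq) t)
  ≺-trans (wrap _ t) (wrap f _) = contradiction f (clash t)

  ≺-connected : ∀ v w → v ≺ w ⊎ v ≡ w ⊎ w ≺ v
  ≺-connected v w with low v in lv | low w in lw | Fin.<-cmp v w
  ... | false | true  | _             = inj₁ (wrap lv lw)
  ... | true  | false | _             = inj₂ (inj₂ (wrap lw lv))
  ... | true  | true  | tri< v<w _ _  = inj₁ (stay (trans lv (sym lw)) v<w)
  ... | false | false | tri< v<w _ _  = inj₁ (stay (trans lv (sym lw)) v<w)
  ... | true  | true  | tri> _ _ w<v  = inj₂ (inj₂ (stay (trans lw (sym lv)) w<v))
  ... | false | false | tri> _ _ w<v  = inj₂ (inj₂ (stay (trans lw (sym lv)) w<v))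
  ... | _     | _     | tri≈ _ v≡w _  = inj₂ (inj₁ v≡w)

  ≺-compare : ∀ v w → Tri (v ≺ w) (v ≡ w) (w ≺ v)
  ≺-compare v w with ≺-connected v w
  ... | inj₁ v≺w         = tri< v≺w (λ { refl → ≺-irrefl v≺w }) (≺-irrefl ∘ ≺-trans v≺w)
  ... | inj₂ (inj₁ refl) = tri≈ ≺-irrefl refl ≺-irrefl
  ... | inj₂ (inj₂ w≺v)  = tri> (≺-irrefl ∘ ≺-trans w≺v) (λ { refl → ≺-irrefl w≺v }) w≺v

  ≺-order : IsStrictTotalOrder _≡_ _≺_
  ≺-order = record
    { isStrictPartialOrder = record
      { isEquivalence = isEquivalence
      ; irrefl = λ { refl → ≺-irrefl }
      ; trans = ≺-trans
      ; <-resp-≈ = resp₂ _≺_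
      }
    ; compare = ≺-compare
    }

  -- Moving an initial segment to the end complements the sets on it, as in passing to antipodes.
  rotate : (Fin n → Bool) → Fin n → Bool
  rotate g v = low v xor g v

  unrotate-high : ∀ f g {v} → low v ≡ false → rotate f ∖ rotate g ∋ v → f ∖ g ∋ v
  unrotate-high f g l r rewrite l = r

  unrotate-low : ∀ f g {v} → low v ≡ true → rotate f ∖ rotate g ∋ v → g ∖ f ∋ v
  unrotate-low f g l (r , r′) rewrite l = Bool.not-injective r′ , Bool.not-injective r

  module < = Slope (Fin.<-isStrictTotalOrder {n})
  module ≺ = Slope ≺-order

  -- Complementing on the low vertices exchanges `f` and `g` there. Three alternating vertices, put
  -- back into the original order, therefore still alternate, possibly with `f` and `g` exchanged;
  -- hence both hypotheses.
  rotate-noAlternation : ∀ {f g} → <.NoAlternation f g → <.NoAlternation g f →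
                         ≺.NoAlternation (rotate f) (rotate g)
  rotate-noAlternation {f} {g} fg gf {x} {y} {z} (stay xy x<y) (stay yz y<z) rx ry rz =
    by-side (low x) refl
    where
    by-side : ∀ b → low x ≡ b → ⊥
    by-side false lx = fg x<y y<z (unrotate-high f g lx rx) (unrotate-high g f ly ry)
                         (unrotate-high f g lz rz)
      where ly = trans (sym xy) lx ; lz = trans (sym yz) ly
    by-side true  lx = gf x<y y<z (unrotate-low f g lx rx) (unrotate-low g f ly ry)
                         (unrotate-low f g lz rz)
      where ly = trans (sym xy) lx ; lz = trans (sym yz) ly
  rotate-noAlternation {f} {g} fg gf (stay xy x<y) (wrap ly lz) rx ry rz =
    gf (low-initial lz lx) x<y
      (unrotate-low f g lz rz) (unrotate-high f g lx rx) (unrotate-high g f ly ry)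
    where lx = trans xy ly
  rotate-noAlternation {f} {g} fg gf (wrap lx ly) (stay yz y<z) rx ry rz =
    fg y<z (low-initial lz lx)
      (unrotate-low g f ly ry) (unrotate-low f g lz rz) (unrotate-high f g lx rx)
    where lz = trans (sym yz) ly
  rotate-noAlternation fg gf (wrap _ t) (wrap f _) = contradiction f (clash t)

-- Initial segments and the choice of the pivot.

prefix : ∀ {n} → ℕ → Fin n → Bool
prefix j v = does (toℕ v ℕ.<? j)

prefix-true⁻ : ∀ {n j} {v : Fin n} → prefix j v ≡ true → toℕ v ℕ.< j
prefix-true⁻ {j = j} {v} eq =
  decidable-stable (toℕ v ℕ.<? j) λ v≮j → clash eq (dec-false (toℕ v ℕ.<? j) v≮j)

prefix-false⁻ : ∀ {n j} {v : Fin n} → prefix j v ≡ false → ¬ toℕ v ℕ.< j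
prefix-false⁻ {j = j} {v} eq v<j = clash (dec-true (toℕ v ℕ.<? j) v<j) eq

prefix-initial : ∀ {n} j {v w : Fin n} → prefix j v ≡ true → prefix j w ≡ false → v Fin.< w
prefix-initial j vj wj = ℕ.<-≤-trans (prefix-true⁻ {j = j} vj) (ℕ.≮⇒≥ (prefix-false⁻ {j = j} wj))

prefix-suc : ∀ {n} {k v : Fin n} → v ≢ k → prefix (suc (toℕ k)) v ≡ prefix (toℕ k) v
prefix-suc {k = k} {v} v≢k with Fin.<-cmp v k
... | tri< v<k _ _ = trans (dec-true (_ ℕ.<? _) (ℕ.m<n⇒m<1+n v<k)) (sym (dec-true (_ ℕ.<? _) v<k))
... | tri≈ _ v≡k _ = contradiction v≡k v≢k
... | tri> ¬v<k _ k<v =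
  trans (dec-false (_ ℕ.<? _) (ℕ.<⇒≱ k<v ∘ ℕ.m<1+n⇒m≤n)) (sym (dec-false (_ ℕ.<? _) ¬v<k))

module Pivot {n m} (e : Fin m → Fin n → Bool) (x : Fin n → Bool)
             (intersecting : ∀ i j → ∃ λ v → e i v ≡ true × e j v ≡ true) where

  side : ℕ → Fin n → Bool
  side j v = prefix j v xor x v

  Within : ℕ → Bool → Fin m → Set
  Within j b i = ∀ v → e i v ≡ true → side j v ≡ b

  within? : ∀ j b i → Dec (Within j b i)
  within? j b i = Fin.all? λ v → (e i v Bool.≟ true) →-dec (side j v Bool.≟ b)

  -- A common vertex of the two edges has only one side.
  within-unique : ∀ j {b b′ i i′} → Within j b i → Within j b′ i′ → b ≡ b′
  within-unique j {i = i} {i′} w w′ = let v , iv , i′v = intersecting i i′ in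
    trans (sym (w v iv)) (w′ v i′v)

  within-suc : ∀ {k b i} → e i k ≡ false → Within (toℕ k) b i → Within (suc (toℕ k)) b i
  within-suc {k} ¬ik w v iv =
    trans (cong (_xor x v) (prefix-suc {k = k} {v} λ { refl → clash iv ¬ik })) (w v iv)

  Stuck : Fin n → Set
  Stuck k = ∃ λ i → e i k ≡ false × (Within (toℕ k) true i ⊎ Within (toℕ k) false i)

  stuck? : Decidable Stuck
  stuck? k = Fin.any? λ i → (e i k Bool.≟ false) ×-dec
    (within? (toℕ k) true i ⊎-dec within? (toℕ k) false i)

  stuck⇒within : ∀ {k} → Stuck k → ∃₂ λ b i → e i k ≡ false × Within (toℕ k) b i
  stuck⇒within (i , ¬ik , inj₁ w) = true , i , ¬ik , w
  stuck⇒within (i , ¬ik , inj₂ w) = false , i , ¬ik , w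

  -- The edge may change but its side may not: the edge that makes the next vertex stuck is on the
  -- same side by `within-unique`, and it misses the only vertex that changes sides.
  within-step : (∀ k → Stuck k) → ∀ {j b} → j ℕ.< n → ∃ (Within j b) → ∃ (Within (suc j) b)
  within-step stuck {j} {b} j<n (i , w) with stuck⇒within (stuck (fromℕ< j<n)) | Fin.toℕ-fromℕ< j<n
  ... | b′ , i′ , ¬i′k , w′ | eq =
    i′ , subst₂ (λ l c → Within (suc l) c i′) eq
           (within-unique (toℕ (fromℕ< j<n)) w′ (subst (λ l → Within l b i) (sym eq) w))
           (within-suc ¬i′k w′)

  within-all : (∀ k → Stuck k) → ∀ {b} → ∃ (Within 0 b) → ∀ {j} → j ℕ.≤ n → ∃ (Within j b)
  within-all stuck w₀ {zero}  _   = w₀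
  within-all stuck w₀ {suc j} j<n = within-step stuck j<n (within-all stuck w₀ (ℕ.<⇒≤ j<n))

  side-flip : ∀ v → side n v ≡ not (side 0 v)
  side-flip v rewrite dec-true (toℕ v ℕ.<? n) (Fin.toℕ<n v) = refl

  -- If every k is stuck, the side containing an edge persists from j = 0 to j = n, while the two
  -- sides are exchanged.
  ¬all-stuck : 0 ℕ.< n → ¬ (∀ k → Stuck k)
  ¬all-stuck 0<n stuck with stuck⇒within (stuck (fromℕ< 0<n)) | Fin.toℕ-fromℕ< 0<n
  ... | b , i , _ , w | eq = let
      w₀ = subst (λ l → Within l b i) eq w
      i′ , wₙ = within-all stuck (i , w₀) ℕ.≤-refl
      v , iv , i′v = intersecting i i′
    in Bool.not-¬ (sym (w₀ v iv)) (trans (sym (wₙ v i′v)) (side-flip v))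

  pivot : 0 ℕ.< n → ∃ λ k → ∀ i → e i k ≡ false → ∀ b → ∃ λ v → side (toℕ k) v ≡ b × e i v ≡ true
  pivot 0<n with Fin.any? (¬? ∘ stuck?)
  ... | no all-stuck =
    contradiction (λ k → decidable-stable (stuck? k) λ ¬s → all-stuck (k , ¬s)) (¬all-stuck 0<n)
  ... | yes (k , ¬stuck) = k , crosses
    where
    crosses : ∀ i → e i k ≡ false → ∀ b → ∃ λ v → side (toℕ k) v ≡ b × e i v ≡ true
    crosses i ¬ik b with Fin.any? (λ v → (side (toℕ k) v Bool.≟ b) ×-dec (e i v Bool.≟ true))
    ... | yes found = found
    -- With no vertex on side `b`, the edge lies wholly on the other side and makes `k` stuck.
    ... | no none = contradiction (stuck-at b λ v iv → Bool.¬-not λ sv → none (v , sv , iv)) ¬stuck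
      where
      stuck-at : ∀ b → Within (toℕ k) (not b) i → Stuck k
      stuck-at true  w = i , ¬ik , inj₂ w
      stuck-at false w = i , ¬ik , inj₁ w

-- The pivot and three more vertices meet every edge.

module FourPoints {n m} (g : Fin m → Fin n → Bool) (σ : Fin m → Bool) (x : Fin n → Bool)
  (aba : ∀ i j → Slope.NoAlternation (Fin.<-isStrictTotalOrder {n}) (g i) (g j)) where

  -- The edges of a pseudohemisphere hypergraph: `σ i` tells whether `g i` is complemented, and `x`
  -- is the indicator of the set `X`.
  e : Fin m → Fin n → Bool
  e i v = σ i xor (g i v xor x v)

  module AtPivot (intersecting : ∀ i j → ∃ λ v → e i v ≡ true × e j v ≡ true) (k : Fin n)
    (crosses : ∀ i → e i k ≡ false → ∀ b →
               ∃ λ v → Pivot.side e x intersecting (toℕ k) v ≡ b × e i v ≡ true) where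

    open Pivot e x intersecting using (side)

    low : Fin n → Bool
    low = prefix (toℕ k)

    open Rotation low (prefix-initial (toℕ k))
      using (_≺_; stay; wrap; ≺-order; rotate; rotate-noAlternation)

    low-k : low k ≡ false
    low-k = dec-false (toℕ k ℕ.<? toℕ k) (ℕ.<-irrefl refl)

    -- The initial segment `low` stops just before `k`, so the shifted order starts at `k`.
    k-min : ∀ {v} → v ≢ k → k ≺ v
    k-min {v} v≢k with low v in lv
    ... | true  = wrap low-k lv
    ... | false = stay (trans low-k (sym lv))
      (ℕ.≤∧≢⇒< (ℕ.≮⇒≥ (prefix-false⁻ lv)) (v≢k ∘ sym ∘ Fin.toℕ-injective))

    -- Sides are measured relative to `k`, just as `hits` measures edges, so that the contributions
    -- of `low` cancel.
    s : Fin n → Bool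
    s v = side (toℕ k) k xor side (toℕ k) v

    open Slope ≺-order using (module Edges)
    open Edges (λ i → rotate (g i)) (λ i j → rotate-noAlternation (aba i j) (aba j i)) k k-min s

    -- The `low` terms cancel and `σ i` can be added twice, which leaves `e i k xor e i v`; the
    -- first term vanishes since the edge misses `k`.
    hits≡e : ∀ i → e i k ≡ false → ∀ v → hits i v ≡ e i v
    hits≡e i ¬ik v = begin
      ((low k xor g i k) xor (low v xor g i v)) xor ((low k xor x k) xor (low v xor x v))
        ≡⟨ cong₂ _xor_ (xor-interchange (low k) (g i k) (low v) (g i v))
                       (xor-interchange (low k) (x k) (low v) (x v)) ⟩
      ((low k xor low v) xor (g i k xor g i v)) xor ((low k xor low v) xor (x k xor x v))
        ≡⟨ xor-cancel (low k xor low v) (g i k xor g i v) (x k xor x v) ⟩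
      (g i k xor g i v) xor (x k xor x v)
        ≡⟨ xor-interchange (g i k) (g i v) (x k) (x v) ⟩
      (g i k xor x k) xor (g i v xor x v)
        ≡⟨ xor-cancel (σ i) (g i k xor x k) (g i v xor x v) ⟨
      e i k xor e i v
        ≡⟨ cong (_xor e i v) ¬ik ⟩
      e i v ∎
      where open ≡-Reasoning

    missing-k : List (Fin m)
    missing-k = filter (λ i → e i k Bool.≟ false) (allFin m)

    missing⁻ : ∀ {i} → i LM.∈ missing-k → e i k ≡ false
    missing⁻ {i} i∈ = proj₂ (∈-filter⁻ (λ i → e i k Bool.≟ false) {v = i} {xs = allFin m} i∈)

    edges-intersect : ∀ {i j} → i LM.∈ missing-k → j LM.∈ missing-k →
                      ∃ λ v → hits i v ≡ true × hits j v ≡ true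
    edges-intersect {i} {j} i∈ j∈ = let v , iv , jv = intersecting i j in
      v , trans (hits≡e i (missing⁻ i∈) v) iv , trans (hits≡e j (missing⁻ j∈) v) jv

    edges-meet : ∀ {i} → i LM.∈ missing-k → ∀ b → ∃ λ v → s v ≡ b × hits i v ≡ true
    edges-meet {i} i∈ b =
      -- Adding the side of `k` to `b` undoes the normalisation in `s`.
      let v , sv , iv = crosses i (missing⁻ i∈) (side (toℕ k) k xor b) in
      v , trans (cong (side (toℕ k) k xor_) sv) (xor-cancelˡ (side (toℕ k) k) b)
        , trans (hits≡e i (missing⁻ i∈) v) iv

    missing⁺ : ∀ i → e i k ≡ false → i LM.∈ missing-k
    missing⁺ i ¬ik = ∈-filter⁺ (λ i → e i k Bool.≟ false) {x = i} {xs = allFin m} (∈-allFin i) ¬ik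

    pierces-all : ∀ u v w →
      All (λ i → ¬ (hits i u ≡ false × hits i v ≡ false × hits i w ≡ false)) missing-k →
      ∀ i → Any (λ v → e i v ≡ true) (k ∷ u ∷ v ∷ w ∷ [])
    pierces-all u v w hit i =
      decidable-stable (Any.any? (λ v → e i v Bool.≟ true) (k ∷ u ∷ v ∷ w ∷ [])) λ none →
        contradict (¬Any⇒All¬ (k ∷ u ∷ v ∷ w ∷ []) none)
      where
      contradict : All (λ v → e i v ≢ true) (k ∷ u ∷ v ∷ w ∷ []) → ⊥
      contradict (¬ik ∷ ¬iu ∷ ¬iv ∷ ¬iw ∷ []) =
        All.lookup {P = λ i → ¬ (hits i u ≡ false × hits i v ≡ false × hits i w ≡ false)} hit {i}
          (missing⁺ i (Bool.¬-not {e i k} ¬ik)) (missed u ¬iu , missed v ¬iv , missed w ¬iw)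
        where
        missed : ∀ v → e i v ≢ true → hits i v ≡ false
        missed v ¬iv = trans (hits≡e i (Bool.¬-not {e i k} ¬ik) v) (Bool.¬-not {e i v} ¬iv)

    threeMorePoints : ∃ λ u → ∃₂ λ v w → ∀ i → Any (λ v → e i v ≡ true) (k ∷ u ∷ v ∷ w ∷ [])
    threeMorePoints = let u , v , w , hit = transversal missing-k edges-intersect edges-meet in
      u , v , w , pierces-all u v w hit

  fourPoints : (∀ i j → ∃ λ v → e i v ≡ true × e j v ≡ true) → 0 ℕ.< n →
    ∃₂ λ k u → ∃₂ λ v w → ∀ i → Any (λ v → e i v ≡ true) (k ∷ u ∷ v ∷ w ∷ [])
  fourPoints intersecting 0<n = let k , crosses = Pivot.pivot e x intersecting 0<n in
    k , AtPivot.threeMorePoints intersecting k crosses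

-- Back to subsets and hypergraphs.

∣p∪q∣≤∣p∣+∣q∣ : ∀ {n} (p q : Subset n) → ∣ p ∪ q ∣ ≤ ∣ p ∣ ℕ.+ ∣ q ∣
∣p∪q∣≤∣p∣+∣q∣ []          []          = z≤n
∣p∪q∣≤∣p∣+∣q∣ (true  ∷ p) (true  ∷ q) =
  s≤s (ℕ.≤-trans (∣p∪q∣≤∣p∣+∣q∣ p q) (ℕ.+-monoʳ-≤ ∣ p ∣ (ℕ.n≤1+n ∣ q ∣)))
∣p∪q∣≤∣p∣+∣q∣ (true  ∷ p) (false ∷ q) = s≤s (∣p∪q∣≤∣p∣+∣q∣ p q)
∣p∪q∣≤∣p∣+∣q∣ (false ∷ p) (true  ∷ q) =
  ℕ.≤-trans (s≤s (∣p∪q∣≤∣p∣+∣q∣ p q)) (ℕ.≤-reflexive (sym (ℕ.+-suc ∣ p ∣ ∣ q ∣)))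
∣p∪q∣≤∣p∣+∣q∣ (false ∷ p) (false ∷ q) = ∣p∪q∣≤∣p∣+∣q∣ p q

fromList : ∀ {n} → List (Fin n) → Subset n
fromList = ⋃ ∘ List.map ⁅_⁆

∣fromList∣≤length : ∀ {n} (vs : List (Fin n)) → ∣ fromList vs ∣ ≤ length vs
∣fromList∣≤length {n} [] = ℕ.≤-reflexive (∣⊥∣≡0 n)
∣fromList∣≤length (v ∷ vs) = ℕ.≤-trans (∣p∪q∣≤∣p∣+∣q∣ ⁅ v ⁆ (fromList vs))
  (ℕ.+-mono-≤ (ℕ.≤-reflexive (∣⁅x⁆∣≡1 v)) (∣fromList∣≤length vs))

∈-fromList : ∀ {n} {v : Fin n} {vs} → v LM.∈ vs → v ∈ fromList vs
∈-fromList (here refl) = x∈p∪q⁺ (inj₁ (x∈⁅x⁆ _))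
∈-fromList (there v∈)  = x∈p∪q⁺ (inj₂ (∈-fromList v∈))

lookup-false⇒∉ : ∀ {n} {v : Fin n} {p : Subset n} → Vec.lookup p v ≡ false → v ∉ p
lookup-false⇒∉ eq v∈p = clash ([]=⇒lookup v∈p) eq

ABA-free⇒noAlternation : ∀ {n} {F : Hypergraph n} → ABA-free F →
  ∀ {A B} → A LM.∈ F → B LM.∈ F →
  Slope.NoAlternation (Fin.<-isStrictTotalOrder {n}) (Vec.lookup A) (Vec.lookup B)
ABA-free⇒noAlternation free {A} {B} A∈ B∈ x<y y<z Ax By Az =
  free A B A∈ B∈ _ _ _ x<y y<z (sep Ax , sep Az , sep By)
  where
  sep : ∀ {p q : Subset _} {v} → Vec.lookup p ∖ Vec.lookup q ∋ v → v ∈ p × v ∉ q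
  sep (pv , qv) = lookup⇒[]= _ _ pv , lookup-false⇒∉ qv

complemented : ∀ {n} {E A B : Subset n} → E ≡ A ⊎ E ≡ B → Bool
complemented (inj₁ _) = false
complemented (inj₂ _) = true

lookup-generated : ∀ {n} {E : Subset n} G X (c : E ≡ G Δ X ⊎ E ≡ ∁ G Δ X) v →
  Vec.lookup E v ≡ complemented c xor (Vec.lookup G v xor Vec.lookup X v)
lookup-generated G X (inj₁ refl) v = lookup-zipWith _xor_ v G X
lookup-generated G X (inj₂ refl) v = begin
  Vec.lookup (∁ G Δ X) v                  ≡⟨ lookup-zipWith _xor_ v (∁ G) X ⟩
  Vec.lookup (∁ G) v xor Vec.lookup X v   ≡⟨ cong (_xor Vec.lookup X v) (lookup-map v not G) ⟩
  not (Vec.lookup G v) xor Vec.lookup X v ≡⟨ Bool.not-distribˡ-xor (Vec.lookup G v) _ ⟨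
  not (Vec.lookup G v xor Vec.lookup X v) ∎
  where open ≡-Reasoning

mainTheorem8 : (n : ℕ) (H : Hypergraph n) → Pseudohemisphere H → Intersecting H →
    Σ (Subset n) λ T → ∣ T ∣ ≤ 4 ×
    (∀ (E : Subset n) → E LM.∈ H → ∃ λ (v : Fin n) → v ∈ T × v ∈ E)
-- An edge meets itself, so without vertices there are no edges; the pivot needs at least one
-- vertex.
mainTheorem8 zero H _ intersecting = [] , z≤n , λ E E∈ →
  contradiction (proj₁ (intersecting E E E∈ E∈)) Fin.¬Fin0
mainTheorem8 n@(suc _) H (X , F , free , generated) intersecting =
  let a , b , c , d , pierces = fourPoints e-intersecting (s≤s z≤n)
      T = a ∷ b ∷ c ∷ d ∷ []
  in fromList T , ∣fromList∣≤length T , λ E E∈ →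
    let v , v∈T , iv = LM.find (pierces (Any.index E∈)) in
    v , ∈-fromList v∈T , subst (v ∈_) (sym (lookup-index E∈))
      (lookup⇒[]= v _ (trans (lookup-edge (Any.index E∈) v) iv))
  where
  edge : Fin (length H) → Subset n
  edge = List.lookup H

  edge-generated : ∀ i → Σ (Subset n) λ G → G LM.∈ F × (edge i ≡ G Δ X ⊎ edge i ≡ ∁ G Δ X)
  edge-generated i = generated (edge i) (∈-lookup i)

  G : Fin (length H) → Subset n
  G i = proj₁ (edge-generated i)

  σ : Fin (length H) → Bool
  σ i = complemented (proj₂ (proj₂ (edge-generated i)))

  open FourPoints (Vec.lookup ∘ G) σ (Vec.lookup X)
    (λ i j → ABA-free⇒noAlternation free
      (proj₁ (proj₂ (edge-generated i))) (proj₁ (proj₂ (edge-generated j))))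

  lookup-edge : ∀ i v → Vec.lookup (edge i) v ≡ e i v
  lookup-edge i = lookup-generated (G i) X (proj₂ (proj₂ (edge-generated i)))

  e-intersecting : ∀ i j → ∃ λ v → e i v ≡ true × e j v ≡ true
  e-intersecting i j = let v , vi , vj = intersecting (edge i) (edge j) (∈-lookup i) (∈-lookup j) in
    v , trans (sym (lookup-edge i v)) ([]=⇒lookup vi) , trans (sym (lookup-edge j v)) ([]=⇒lookup vj)
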